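{- Let $\mathcal{R}$ be a non-duplicating probabilistic term rewrite system (PTRS), and let $\mathcal{DP}(\mathcal{R})$ be its set of canonical annotated dependency pairs. Then $\mathcal{R}$ is almost-surely terminating ($\mathtt{AST}$) if and only if the ADP problem $\mathcal{DP}(\mathcal{R})$ is $\mathtt{AST}$.
   Context: **Terms.** $\Sigma$ is a finite signature, $\mathcal{V}$ a set of variables, $\mathcal{T}=\mathcal{T}(\Sigma,\mathcal{V})$ the set of terms. $\mathcal{V}(t)$ is the set of variables of $t$; $\mathrm{Pos}(t)$ the set of positions of $t$ (root position $\varepsilon$); $t|_\pi$ the subterm at $\pi$; $t[r]_\pi$ the replacement of that subterm by $r$. A substitution is $\sigma:\mathcal{V}\to\mathcal{T}$ with $\sigma(x)=x$ for all but finitely many $x$. **PTRSs.** A finite multi-distribution on a set $M$ is a finite multiset of pairs $(p:a)$ with $0<p\le 1$, $a\in M$, whose probabilities sum to $1$; $\mathrm{Supp}(\mu)$ is the multiset of the $a$'s occurring in $\mu$. A probabilistic rule $\ell\to\mu$ consists of a term $\ell\in\mathcal{T}\setminus\mathcal{V}$ and a finite multi-distribution $\mu$ on $\mathcal{T}$ with $\mathcal{V}(r)\subseteq\mathcal{V}(\ell)$ for all $r\in\mathrm{Supp}(\mu)$. A PTRS $\mathcal{R}$ is a finite set of such rules. It is non-duplicating if for every $\ell\to\mu\in\mathcal{R}$ and $r\in\mathrm{Supp}(\mu)$, every variable occurs at most as often in $r$ as in $\ell$. We have $s\to_{\mathcal{R}}\{p_1:t_1,\dots,p_k:t_k\}$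 if there are $\ell\to\{p_1:r_1,\dots,p_k:r_k\}\in\mathcal{R}$, a substitution $\sigma$ and $\pi\in\mathrm{Pos}(s)$ with $s|_\pi=\ell\sigma$ and $t_j=s[r_j\sigma]_\pi$ for all $j$. **AST of a PTRS.** An $\mathcal{R}$-rewrite sequence tree (RST) is a (possibly infinite) finitely branching tree whose nodes $v$ are labeled by pairs $(p_v:t_v)$ of a probability and a term, the root having probability $1$, such that for each node $v$ with successors $w_1,\dots,w_k$ ($k\ge1$), $t_v\to_{\mathcal{R}}\{\frac{p_{w_1}}{p_v}:t_{w_1},\dots,\frac{p_{w_k}}{p_v}:t_{w_k}\}$. For such a tree $\mathfrak{T}$, $|\mathfrak{T}|_{\mathrm{Leaf}}$ is the sum of $p_v$ over all leaves $v$. $\mathcal{R}$ is $\mathtt{AST}$ if $|\mathfrak{T}|_{\mathrm{Leaf}}=1$ for all $\mathcal{R}$-RSTs $\mathfrak{T}$. **Annotations.** $\mathcal{D}\subseteq\Sigma$ is the set of defined symbols, i.e., root symbols of left-hand sides of rules of $\mathcal{R}$. For each $f\in\mathcal{D}$ let $f^\#$ be a fresh symbol of the same arity; $\mathcal{D}^\#=\{f^\#\mid f\in\mathcal{D}\}$, $\Sigma^\#=\Sigma\uplus\mathcal{D}^\#$, $\mathcal{T}^\#=\mathcal{T}(\Sigma^\#,\mathcal{V})$. $\mathrm{Pos}_X(t)$ is the set of positions of $t$ carrying a symbol or variable from $X$. For $\Phi\subseteq\mathrm{Pos}_{\mathcal{D}\cup\mathcal{D}^\#}(t)$, $\#_\Phi(t)$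 is the variant of $t$ where exactly the symbols at positions in $\Phi$ are annotated (all other annotations are removed); $\flat(t)=\#_\emptyset(t)$. $\flat^\uparrow_\pi(t)$ results from $t$ by removing all annotations strictly above position $\pi$. **ADPs.** An annotated dependency pair (ADP) has the form $\ell\to\{p_1:r_1,\dots,p_k:r_k\}^m$ with $\ell\in\mathcal{T}\setminus\mathcal{V}$, $m\in\{\mathsf{true},\mathsf{false}\}$, $r_j\in\mathcal{T}^\#$, $\mathcal{V}(r_j)\subseteq\mathcal{V}(\ell)$, probabilities $p_j\in(0,1]$ summing to $1$. An ADP problem is a finite set of ADPs. The canonical ADP of a rule $\ell\to\{p_1:r_1,\dots,p_k:r_k\}$ is $\ell\to\{p_1:\#_{\mathrm{Pos}_{\mathcal{D}}(r_1)}(r_1),\dots,p_k:\#_{\mathrm{Pos}_{\mathcal{D}}(r_k)}(r_k)\}^{\mathsf{true}}$; $\mathcal{DP}(\mathcal{R})$ is the set of canonical ADPs of all rules of $\mathcal{R}$. **Rewriting with ADPs.** A variable reposition function (VRF) for an ADP $\ell\to\{p_1:r_1,\dots,p_k:r_k\}^m$ is a family of functions $\varphi_j:\mathrm{Pos}_{\mathcal{V}}(\ell)\to\mathrm{Pos}_{\mathcal{V}}(r_j)\uplus\{\bot\}$, $1\le j\le k$, with $\ell|_\rho=r_j|_{\varphi_j(\rho)}$ whenever $\varphi_j(\rho)\ne\bot$. For an ADP problem $\mathcal{P}$, a term $s\in\mathcal{T}^\#$ rewrites with $\mathcal{P}$ to $\{p_1:t_1,\dots,p_k:t_k\}$ (written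 $s\hookrightarrow_{\mathcal{P}}\{p_1:t_1,\dots,p_k:t_k\}$) if there are an ADP $\ell\to\{p_1:r_1,\dots,p_k:r_k\}^m\in\mathcal{P}$, a VRF $(\varphi_j)_j$ for it, a substitution $\sigma$ and $\pi\in\mathrm{Pos}_{\mathcal{D}\cup\mathcal{D}^\#}(s)$ with $\flat(s|_\pi)=\ell\sigma$, such that for all $j$: - (at) $t_j=s[\#_{\Phi_j}(r_j\sigma)]_\pi$ if $\pi\in\mathrm{Pos}_{\mathcal{D}^\#}(s)$ and $m=\mathsf{true}$; - (af) $t_j=\flat^\uparrow_\pi(s[\#_{\Phi_j}(r_j\sigma)]_\pi)$ if $\pi\in\mathrm{Pos}_{\mathcal{D}^\#}(s)$ and $m=\mathsf{false}$; - (nt) $t_j=s[\#_{\Psi_j}(r_j\sigma)]_\pi$ if $\pi\notin\mathrm{Pos}_{\mathcal{D}^\#}(s)$ and $m=\mathsf{true}$. (There is no step if $\pi\notin\mathrm{Pos}_{\mathcal{D}^\#}(s)$ and $m=\mathsf{false}$.) Here $\Psi_j=\{\varphi_j(\rho).\tau\mid\rho\in\mathrm{Pos}_{\mathcal{V}}(\ell),\ \varphi_j(\rho)\ne\bot,\ \rho.\tau\in\mathrm{Pos}_{\mathcal{D}^\#}(s|_\pi)\}$ and $\Phi_j=\mathrm{Pos}_{\mathcal{D}^\#}(r_j)\cup\Psi_j$. **Chain trees and AST of an ADP problem.** A $\mathcal{P}$-chain tree (CT) is $\mathfrak{T}=(V,E,L,A)$ where $(V,E)$ is a non-empty, possibly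 infinite, finitely branching directed tree; $L$ labels each node $v$ by a probability $p_v\in(0,1]$ and a term $t_v\in\mathcal{T}^\#$, with $p_v=1$ for the root; $A$ is a subset of the inner nodes; for each inner node $v$ with successors $w_1,\dots,w_k$, $t_v\hookrightarrow_{\mathcal{P}}\{\frac{p_{w_1}}{p_v}:t_{w_1},\dots,\frac{p_{w_k}}{p_v}:t_{w_k}\}$ using case (at) or (af) if $v\in A$ and another case if $v\notin A$; and every infinite path contains infinitely many nodes from $A$. $|\mathfrak{T}|_{\mathrm{Leaf}}$ is the sum of $p_v$ over all leaves $v$. $\mathcal{P}$ is $\mathtt{AST}$ if $|\mathfrak{T}|_{\mathrm{Leaf}}=1$ for all $\mathcal{P}$-CTs $\mathfrak{T}$. -}

module Defs where

open import Data.Bool.Base using (Bool; true; false; T; _∧_; if_then_else_)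
open import Data.Bool.ListAction using (any)
open import Data.Fin.Base using (Fin)
import Data.Fin.Properties as Fin
open import Data.List.Base as List using (List; []; _∷_; _++_; foldr; filter; length)
open import Data.List.Membership.Propositional using (_∈_; _∉_)
import Data.List.Membership.DecPropositional as DecMembership
open import Data.List.Properties using (≡-dec; map-∘)
open import Data.List.Relation.Binary.Permutation.Propositional using (_↭_)
open import Data.List.Relation.Binary.Pointwise using (Pointwise)
open import Data.List.Relation.Binary.Subset.Propositional using (_⊆_)
open import Data.List.Relation.Unary.All as All using (All)
import Data.List.Relation.Unary.All.Properties as All
open import Data.List.Relation.Unary.Unique.Propositional using (Unique)
open import Data.Maybe.Base using (Maybe; just; nothing; maybe; _>>=_)
import Data.Maybe.Properties as Maybe
open import Data.Nat.Base as ℕ using (ℕ; zero; suc)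
import Data.Nat.Properties as ℕ
open import Data.Product.Base using (∃; _×_; _,_; proj₁; proj₂; map₂)
open import Data.Rational.Base as ℚ using (ℚ; 0ℚ; 1ℚ; ½)
import Data.Rational.Properties as ℚ
open import Data.Rational.Solver using (module +-*-Solver)
open import Data.Sum.Base using (_⊎_; inj₁; inj₂; [_,_]′)
open import Data.Vec.Base using (Vec; []; _∷_)
open import Function.Base using (_∘_; const)
open import Function.Bundles using (_↔_)
open import Function.Properties.Inverse using (↔⇒↣)
open import Level using (0ℓ)
open import Relation.Binary.Construct.Closure.ReflexiveTransitive using (Star)
open import Relation.Binary.Definitions using (DecidableEquality)
open import Relation.Binary.PropositionalEquality hiding ([_])
open import Relation.Nullary.Decidable using (does)
open import Relation.Nullary.Irrelevant using (Irrelevant)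
open import Relation.Nullary.Negation using (¬_)
open import Relation.Unary using (Pred; Decidable)

-- Real numbers: Cauchy sequences of rationals, with equality _≃_.

IsCauchy : (ℕ → ℚ) → Set
IsCauchy a = ∀ ε → 0ℚ ℚ.< ε → ∃ λ N → ∀ m n → N ℕ.≤ m → N ℕ.≤ n → ℚ.∣ a m ℚ.- a n ∣ ℚ.< ε

record ℝ : Set where
  no-eta-equality
  constructor mkℝ
  field
    seq    : ℕ → ℚ
    cauchy : IsCauchy seq
open ℝ public

fromℚ : ℚ → ℝ
fromℚ q = mkℝ (λ _ → q) λ ε 0<ε → 0 , λ _ _ _ _ →
  subst (λ z → ℚ.∣ z ∣ ℚ.< ε) (sym (ℚ.+-inverseʳ q)) 0<ε

0ℝ 1ℝ : ℝ
0ℝ = fromℚ 0ℚ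
1ℝ = fromℚ 1ℚ

infix 4 _≃_ _≤ℝ_ _<ℝ_
infixl 6 _+ℝ_
infixl 7 _*ℝ_

record _≃_ (x y : ℝ) : Set where
  constructor mk≃
  field close : ∀ ε → 0ℚ ℚ.< ε → ∃ λ N → ∀ n → N ℕ.≤ n → ℚ.∣ seq x n ℚ.- seq y n ∣ ℚ.< ε

record _≤ℝ_ (x y : ℝ) : Set where
  constructor mk≤
  field below : ∀ ε → 0ℚ ℚ.< ε → ∃ λ N → ∀ n → N ℕ.≤ n → seq x n ℚ.< seq y n ℚ.+ ε

record _<ℝ_ (x y : ℝ) : Set where
  constructor mk<
  field gap : ∃ λ ε → 0ℚ ℚ.< ε × ∃ λ N → ∀ n → N ℕ.≤ n → seq x n ℚ.+ ε ℚ.≤ seq y n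

private
  open ℚ.≤-Reasoning
  open +-*-Solver

  sub-add : ∀ a b → a ≡ (a ℚ.- b) ℚ.+ b
  sub-add = solve 2 (λ a b → a := (a :- b) :+ b) refl

  sum-sub : ∀ a b c d → (a ℚ.+ b) ℚ.- (c ℚ.+ d) ≡ (a ℚ.- c) ℚ.+ (b ℚ.- d)
  sum-sub = solve 4 (λ a b c d → (a :+ b) :- (c :+ d) := (a :- c) :+ (b :- d)) refl

  prod-sub : ∀ a b c d → a ℚ.* b ℚ.- c ℚ.* d ≡ a ℚ.* (b ℚ.- d) ℚ.+ d ℚ.* (a ℚ.- c)
  prod-sub = solve 4 (λ a b c d → a :* b :- c :* d := a :* (b :- d) :+ d :* (a :- c)) refl

  half : ∀ ε → 0ℚ ℚ.< ε → 0ℚ ℚ.< ½ ℚ.* ε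
  half ε 0<ε = subst (ℚ._< ½ ℚ.* ε) (ℚ.*-zeroʳ ½) (ℚ.*-monoʳ-<-pos ½ 0<ε)

  halves : ∀ ε → ½ ℚ.* ε ℚ.+ ½ ℚ.* ε ≡ ε
  halves ε = trans (sym (ℚ.*-distribʳ-+ ε ½ ½)) (ℚ.*-identityˡ ε)

  tailBound : (x : ℝ) → ∃ λ B → 0ℚ ℚ.< B × ∃ λ N → ∀ n → N ℕ.≤ n → ℚ.∣ seq x n ∣ ℚ.< B
  tailBound x with N , h ← cauchy x 1ℚ (ℚ.positive⁻¹ 1ℚ) =
    1ℚ ℚ.+ ℚ.∣ seq x N ∣
    , ℚ.+-mono-<-≤ {0ℚ} {1ℚ} (ℚ.positive⁻¹ 1ℚ) (ℚ.0≤∣p∣ (seq x N))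
    , N , λ n N≤n → begin-strict
        ℚ.∣ seq x n ∣
          ≡⟨ cong ℚ.∣_∣ (sub-add (seq x n) (seq x N)) ⟩
        ℚ.∣ (seq x n ℚ.- seq x N) ℚ.+ seq x N ∣
          ≤⟨ ℚ.∣p+q∣≤∣p∣+∣q∣ (seq x n ℚ.- seq x N) (seq x N) ⟩
        ℚ.∣ seq x n ℚ.- seq x N ∣ ℚ.+ ℚ.∣ seq x N ∣
          <⟨ ℚ.+-monoˡ-< ℚ.∣ seq x N ∣ (h n N N≤n ℕ.≤-refl) ⟩
        1ℚ ℚ.+ ℚ.∣ seq x N ∣ ∎

  *-mono-bound : ∀ {a b c d} → ℚ.∣ a ∣ ℚ.< b → 0ℚ ℚ.< d → ℚ.∣ c ∣ ℚ.< d →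
                 ℚ.∣ a ℚ.* c ∣ ℚ.< b ℚ.* d
  *-mono-bound {a} {b} {c} {d} a<b 0<d c<d = begin-strict
    ℚ.∣ a ℚ.* c ∣          ≡⟨ ℚ.∣p*q∣≡∣p∣*∣q∣ a c ⟩
    ℚ.∣ a ∣ ℚ.* ℚ.∣ c ∣    ≤⟨ ℚ.*-monoˡ-≤-nonNeg ℚ.∣ a ∣ {{ℚ.∣-∣-nonNeg a}} (ℚ.<⇒≤ c<d) ⟩
    ℚ.∣ a ∣ ℚ.* d          <⟨ ℚ.*-monoˡ-<-pos d {{ℚ.positive 0<d}} a<b ⟩
    b ℚ.* d                ∎

  prod-close : ∀ {a b c d B C δ} → ℚ.∣ a ∣ ℚ.< B → ℚ.∣ d ∣ ℚ.< C → 0ℚ ℚ.< δ →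
               ℚ.∣ b ℚ.- d ∣ ℚ.< δ → ℚ.∣ a ℚ.- c ∣ ℚ.< δ →
               ℚ.∣ a ℚ.* b ℚ.- c ℚ.* d ∣ ℚ.< (B ℚ.+ C) ℚ.* δ
  prod-close {a} {b} {c} {d} {B} {C} {δ} a<B d<C 0<δ b-d<δ a-c<δ = begin-strict
    ℚ.∣ a ℚ.* b ℚ.- c ℚ.* d ∣
      ≡⟨ cong ℚ.∣_∣ (prod-sub a b c d) ⟩
    ℚ.∣ a ℚ.* (b ℚ.- d) ℚ.+ d ℚ.* (a ℚ.- c) ∣
      ≤⟨ ℚ.∣p+q∣≤∣p∣+∣q∣ (a ℚ.* (b ℚ.- d)) (d ℚ.* (a ℚ.- c)) ⟩
    ℚ.∣ a ℚ.* (b ℚ.- d) ∣ ℚ.+ ℚ.∣ d ℚ.* (a ℚ.- c) ∣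
      <⟨ ℚ.+-mono-< (*-mono-bound {a} {B} {b ℚ.- d} {δ} a<B 0<δ b-d<δ)
                    (*-mono-bound {d} {C} {a ℚ.- c} {δ} d<C 0<δ a-c<δ) ⟩
    B ℚ.* δ ℚ.+ C ℚ.* δ
      ≡⟨ ℚ.*-distribʳ-+ δ B C ⟨
    (B ℚ.+ C) ℚ.* δ ∎

  divide : ∀ K ε → 0ℚ ℚ.< K → 0ℚ ℚ.< ε → ∃ λ δ → 0ℚ ℚ.< δ × K ℚ.* δ ≡ ε
  divide K ε 0<K 0<ε = ℚ.1/ K ℚ.* ε
    , subst (ℚ._< ℚ.1/ K ℚ.* ε) (ℚ.*-zeroʳ (ℚ.1/ K)) (ℚ.*-monoʳ-<-pos (ℚ.1/ K) 0<ε)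
    , trans (sym (ℚ.*-assoc K (ℚ.1/ K) ε))
        (trans (cong (ℚ._* ε) (ℚ.*-inverseʳ K)) (ℚ.*-identityˡ ε))
    where
    instance
      K-pos : ℚ.Positive K
      K-pos = ℚ.positive 0<K
      K-nonZero : ℚ.NonZero K
      K-nonZero = ℚ.pos⇒nonZero K
      1/K-pos : ℚ.Positive (ℚ.1/ K)
      1/K-pos = ℚ.1/pos⇒pos K

abstract
  +-cauchy : ∀ x y → IsCauchy (λ n → seq x n ℚ.+ seq y n)
  +-cauchy x y ε 0<ε =
    let (M , f) = cauchy x (½ ℚ.* ε) (half ε 0<ε)
        (N , g) = cauchy y (½ ℚ.* ε) (half ε 0<ε)
    in M ℕ.⊔ N , λ m n m≥ n≥ → begin-strict
      ℚ.∣ (seq x m ℚ.+ seq y m) ℚ.- (seq x n ℚ.+ seq y n) ∣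
        ≡⟨ cong ℚ.∣_∣ (sum-sub (seq x m) (seq y m) (seq x n) (seq y n)) ⟩
      ℚ.∣ (seq x m ℚ.- seq x n) ℚ.+ (seq y m ℚ.- seq y n) ∣
        ≤⟨ ℚ.∣p+q∣≤∣p∣+∣q∣ (seq x m ℚ.- seq x n) (seq y m ℚ.- seq y n) ⟩
      ℚ.∣ seq x m ℚ.- seq x n ∣ ℚ.+ ℚ.∣ seq y m ℚ.- seq y n ∣
        <⟨ ℚ.+-mono-< (f m n (ℕ.m⊔n≤o⇒m≤o M N m≥) (ℕ.m⊔n≤o⇒m≤o M N n≥))
                      (g m n (ℕ.m⊔n≤o⇒n≤o M N m≥) (ℕ.m⊔n≤o⇒n≤o M N n≥)) ⟩
      ½ ℚ.* ε ℚ.+ ½ ℚ.* ε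
        ≡⟨ halves ε ⟩
      ε ∎

  *-cauchy : ∀ x y → IsCauchy (λ n → seq x n ℚ.* seq y n)
  *-cauchy x y ε 0<ε =
    let (B , 0<B , N₁ , h₁) = tailBound x
        (C , 0<C , N₂ , h₂) = tailBound y
        (δ , 0<δ , K*δ≡ε)   = divide (B ℚ.+ C) ε (ℚ.+-mono-< {0ℚ} {B} {0ℚ} {C} 0<B 0<C) 0<ε
        (N₃ , f) = cauchy x δ 0<δ
        (N₄ , g) = cauchy y δ 0<δ
        left : ∀ {n} → (N₁ ℕ.⊔ N₂) ℕ.⊔ (N₃ ℕ.⊔ N₄) ℕ.≤ n → N₁ ℕ.⊔ N₂ ℕ.≤ n
        left  = ℕ.m⊔n≤o⇒m≤o (N₁ ℕ.⊔ N₂) (N₃ ℕ.⊔ N₄)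
        right : ∀ {n} → (N₁ ℕ.⊔ N₂) ℕ.⊔ (N₃ ℕ.⊔ N₄) ℕ.≤ n → N₃ ℕ.⊔ N₄ ℕ.≤ n
        right = ℕ.m⊔n≤o⇒n≤o (N₁ ℕ.⊔ N₂) (N₃ ℕ.⊔ N₄)
    in (N₁ ℕ.⊔ N₂) ℕ.⊔ (N₃ ℕ.⊔ N₄) , λ m n m≥ n≥ →
      subst (ℚ.∣ seq x m ℚ.* seq y m ℚ.- seq x n ℚ.* seq y n ∣ ℚ.<_) K*δ≡ε
        (prod-close {seq x m} {seq y m} {seq x n} {seq y n} {B} {C} {δ}
          (h₁ m (ℕ.m⊔n≤o⇒m≤o N₁ N₂ (left m≥)))
          (h₂ n (ℕ.m⊔n≤o⇒n≤o N₁ N₂ (left n≥)))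
          0<δ
          (g m n (ℕ.m⊔n≤o⇒n≤o N₃ N₄ (right m≥)) (ℕ.m⊔n≤o⇒n≤o N₃ N₄ (right n≥)))
          (f m n (ℕ.m⊔n≤o⇒m≤o N₃ N₄ (right m≥)) (ℕ.m⊔n≤o⇒m≤o N₃ N₄ (right n≥))))

_+ℝ_ _*ℝ_ : ℝ → ℝ → ℝ
x +ℝ y = mkℝ (λ n → seq x n ℚ.+ seq y n) (+-cauchy x y)
x *ℝ y = mkℝ (λ n → seq x n ℚ.* seq y n) (*-cauchy x y)

sumℝ : List ℝ → ℝ
sumℝ = foldr _+ℝ_ 0ℝ

IsProbability : ℝ → Set
IsProbability p = 0ℝ <ℝ p × p ≤ℝ 1ℝ

-- The list stands for the multiset of its entries.
record MultiDist (A : Set) : Set where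
  field
    entries     : List (ℝ × A)
    probability : All (IsProbability ∘ proj₁) entries
    total       : sumℝ (List.map proj₁ entries) ≃ 1ℝ
open MultiDist public

mapDist : ∀ {A B} → (A → B) → MultiDist A → MultiDist B
mapDist f μ = record
  { entries     = List.map (map₂ f) (entries μ)
  ; probability = All.map⁺ (probability μ)
  ; total       = subst (λ ps → sumℝ ps ≃ 1ℝ) (sym same) (total μ)
  }
  where
  same : List.map proj₁ (List.map (map₂ f) (entries μ)) ≡ List.map proj₁ (entries μ)
  same = sym (map-∘ (entries μ))

Finite : Set → Set
Finite A = ∃ λ n → A ↔ Fin n

finite⇒≟ : ∀ {A} → Finite A → DecidableEquality A
finite⇒≟ (_ , A↔Fin) = Fin.inj⇒≟ (↔⇒↣ A↔Fin)

record Signature : Set₁ where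
  field
    Symbol : Set
    arity  : Symbol → ℕ
open Signature public

data Term (S : Signature) (V : Set) : Set where
  var : V → Term S V
  fun : (f : Symbol S) → Vec (Term S V) (arity S f) → Term S V

-- A position lists argument indices, counted from 0, from the root downwards.
Position : Set
Position = List ℕ

at? : ∀ {A : Set} {n} → ℕ → Vec A n → Maybe A
at? i       []       = nothing
at? zero    (x ∷ xs) = just x
at? (suc i) (x ∷ xs) = at? i xs

modifyAt : ∀ {A : Set} {n} → ℕ → (A → A) → Vec A n → Vec A n
modifyAt i       g []       = []
modifyAt zero    g (x ∷ xs) = g x ∷ xs
modifyAt (suc i) g (x ∷ xs) = x ∷ modifyAt i g xs

module _ {S : Signature} {V : Set} where

  root : Term S V → Maybe (Symbol S)
  root (var x)    = nothing
  root (fun f ts) = just f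

  vars  : Term S V → List V
  vars* : ∀ {n} → Vec (Term S V) n → List V
  vars (var x)    = x ∷ []
  vars (fun f ts) = vars* ts
  vars* []       = []
  vars* (t ∷ ts) = vars t ++ vars* ts

  Pos  : (Symbol S ⊎ V → Bool) → Term S V → List Position
  Pos* : (Symbol S ⊎ V → Bool) → ℕ → ∀ {n} → Vec (Term S V) n → List Position
  Pos X (var x)    = if X (inj₂ x) then [] ∷ [] else []
  Pos X (fun f ts) = (if X (inj₁ f) then [] ∷ [] else []) ++ Pos* X 0 ts
  Pos* X i []       = []
  Pos* X i (t ∷ ts) = List.map (i ∷_) (Pos X t) ++ Pos* X (suc i) ts

  PosV : Term S V → List Position
  PosV = Pos [ const false , const true ]′

  infix 8 _∣_
  _∣_ : Term S V → Position → Maybe (Term S V)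
  t        ∣ []      = just t
  var x    ∣ (i ∷ π) = nothing
  fun f ts ∣ (i ∷ π) = at? i ts >>= λ t → t ∣ π

  -- Only meaningful at positions of the first term; elsewhere nothing is replaced.
  infix 8 _[_]at_
  _[_]at_ : Term S V → Term S V → Position → Term S V
  t        [ r ]at []      = r
  var x    [ r ]at (i ∷ π) = var x
  fun f ts [ r ]at (i ∷ π) = fun f (modifyAt i (λ t → t [ r ]at π) ts)

  bind  : (V → Term S V) → Term S V → Term S V
  bind* : (V → Term S V) → ∀ {n} → Vec (Term S V) n → Vec (Term S V) n
  bind σ (var x)    = σ x
  bind σ (fun f ts) = fun f (bind* σ ts)
  bind* σ []       = []
  bind* σ (t ∷ ts) = bind σ t ∷ bind* σ ts

record Substitution (S : Signature) (V : Set) : Set where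
  field
    apply  : V → Term S V
    finite : ∃ λ xs → ∀ x → x ∉ xs → apply x ≡ var x
open Substitution public

record ProbRule (S : Signature) (V : Set) : Set where
  field
    lhs         : Term S V
    nonVariable : ∀ x → lhs ≢ var x
    rhs         : MultiDist (Term S V)
    vars⊆       : All (λ (_ , r) → vars r ⊆ vars lhs) (entries rhs)

PTRS : Signature → Set → Set
PTRS S V = List (ProbRule S V)

NonDuplicating : ∀ {S V} → DecidableEquality V → PTRS S V → Set
NonDuplicating _≟_ R = ∀ {rule} → rule ∈ R →
  All (λ (_ , r) → ∀ x → occurrences x r ℕ.≤ occurrences x (lhs rule)) (entries (rhs rule))
  where
  open ProbRule
  occurrences = λ x t → length (filter (x ≟_) (vars t))

record Rewrites {S V} (R : PTRS S V) (s : Term S V) (μ : List (ℝ × Term S V)) : Set where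
  open ProbRule
  field
    rule   : ProbRule S V
    rule∈R : rule ∈ R
    σ      : Substitution S V
    π      : Position
    redex  : s ∣ π ≡ just (bind (apply σ) (lhs rule))
    result : Pointwise (λ (p , r) (q , t) → p ≃ q × t ≡ s [ bind (apply σ) r ]at π)
                       (entries (rhs rule)) μ

-- Nodes carry a probability and an element of A. The proofs of w ∈ succ v are part of a
-- path, so uniqueness of paths also excludes listing a successor twice.
record ProbTree (A : Set) : Set₁ where
  field
    Node : Set
    top  : Node
    succ : Node → List Node

  Edge : Node → Node → Set
  Edge v w = w ∈ succ v

  field
    reachable  : ∀ v → Star Edge top v
    uniquePath : ∀ v → Irrelevant (Star Edge top v)
    prob       : Node → ℝ
    label      : Node → A
    isProb     : ∀ v → IsProbability (prob v)
    prob-top   : prob top ≃ 1ℝ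

  Leaf Inner : Node → Set
  Leaf  v = succ v ≡ []
  Inner v = succ v ≢ []

  -- μ is the multiset of all (p_w / p_v : t_w) with w a successor of v; the quotient q
  -- is described by p_w = p_v · q, where p_v > 0.
  SuccDist : Node → List (ℝ × A) → Set
  SuccDist v μ = ∃ λ ws → ws ↭ succ v ×
    Pointwise (λ w (q , t) → prob w ≃ prob v *ℝ q × label w ≡ t) ws μ

  LeafSet : List Node → Set
  LeafSet vs = Unique vs × All Leaf vs

  -- r is the sum of the probabilities of all leaves: the supremum of the sums over
  -- finite sets of leaves.
  LeafSum : ℝ → Set
  LeafSum r =
    (∀ vs → LeafSet vs → sumℝ (List.map prob vs) ≤ℝ r) ×
    (∀ ε → 0ℚ ℚ.< ε → ∃ λ vs → LeafSet vs × r <ℝ sumℝ (List.map prob vs) +ℝ fromℚ ε)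

record RST {S V} (R : PTRS S V) : Set₁ where
  field
    tree : ProbTree (Term S V)
  open ProbTree tree public
  field
    step : ∀ v → Inner v → ∃ λ μ → SuccDist v μ × Rewrites R (label v) μ

AST : ∀ {S V} → PTRS S V → Set₁
AST R = (𝔗 : RST R) → RST.LeafSum 𝔗 1ℝ

definedSymbols : ∀ {S V} → DecidableEquality (Symbol S) → PTRS S V → Symbol S → Bool
definedSymbols _≟_ R f =
  any (λ rule → does (Maybe.≡-dec _≟_ (root (ProbRule.lhs rule)) (just f))) R

-- A symbol of Σ ⊎ D♯: f itself is (f , false), and f♯ is (f , true), present only for f in D.
record Symbol♯ (S : Signature) (D : Symbol S → Bool) : Set where
  constructor sym♯
  field
    base       : Symbol S
    annotated  : Bool
    .isDefined : T annotated → T (D base)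
open Symbol♯ public

module Annotated (S : Signature) (V : Set) (D : Symbol S → Bool) where

  open DecMembership (≡-dec ℕ._≟_) using (_∈?_)

  S♯ : Signature
  S♯ = record { Symbol = Symbol♯ S D ; arity = arity S ∘ base }

  Term♯ : Set
  Term♯ = Term S♯ V

  PosD : Term S V → List Position
  PosD = Pos [ D , const false ]′

  PosD♯ PosD∪D♯ : Term♯ → List Position
  PosD♯   = Pos [ annotated , const false ]′
  PosD∪D♯ = Pos [ D ∘ base , const false ]′

  mark : Bool → Symbol S → Symbol♯ S D
  mark b f = sym♯ f (b ∧ D f) (∧-elimʳ b (D f))
    where
    ∧-elimʳ : ∀ x y → T (x ∧ y) → T y
    ∧-elimʳ true y t = t

  embed  : Term S V → Term♯
  embed* : ∀ {n} → Vec (Term S V) n → Vec Term♯ n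
  embed (var x)    = var x
  embed (fun f ts) = fun (mark false f) (embed* ts)
  embed* []       = []
  embed* (t ∷ ts) = embed t ∷ embed* ts

  ♭  : Term♯ → Term S V
  ♭* : ∀ {n} → Vec Term♯ n → Vec (Term S V) n
  ♭ (var x)    = var x
  ♭ (fun g ts) = fun (base g) (♭* ts)
  ♭* []       = []
  ♭* (t ∷ ts) = ♭ t ∷ ♭* ts

  annotate  : (Position → Bool) → Term♯ → Term♯
  annotate* : (ℕ → Position → Bool) → ∀ {n} → Vec Term♯ n → Vec Term♯ n
  annotate χ (var x)    = var x
  annotate χ (fun g ts) = fun (mark (χ []) (base g)) (annotate* (λ i π → χ (i ∷ π)) ts)
  annotate* χ []       = []
  annotate* χ (t ∷ ts) = annotate (χ 0) t ∷ annotate* (χ ∘ suc) ts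

  -- Φ is a finite set of positions, so only membership in the list matters.
  #⟨_⟩ : List Position → Term♯ → Term♯
  #⟨ Φ ⟩ = annotate (λ π → does (π ∈? Φ))

  -- Removes the annotations at the proper prefixes of π only.
  ♭↑ : Position → Term♯ → Term♯
  ♭↑ []      t          = t
  ♭↑ (i ∷ π) (var x)    = var x
  ♭↑ (i ∷ π) (fun g ts) = fun (mark false (base g)) (modifyAt i (♭↑ π) ts)

  record ADP : Set where
    field
      lhs         : Term S V
      nonVariable : ∀ x → lhs ≢ var x
      rhs         : MultiDist Term♯
      flag        : Bool
      vars⊆       : All (λ (_ , r) → vars r ⊆ vars lhs) (entries rhs)
  open ADP public

  ADPProblem : Set
  ADPProblem = List ADP

  vars-embed  : ∀ t → vars (embed t) ≡ vars t
  vars-embed* : ∀ {n} (ts : Vec (Term S V) n) → vars* (embed* ts) ≡ vars* ts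
  vars-embed (var x)    = refl
  vars-embed (fun f ts) = vars-embed* ts
  vars-embed* []       = refl
  vars-embed* (t ∷ ts) = cong₂ _++_ (vars-embed t) (vars-embed* ts)

  vars-annotate  : ∀ χ t → vars (annotate χ t) ≡ vars t
  vars-annotate* : ∀ χ {n} (ts : Vec Term♯ n) → vars* (annotate* χ ts) ≡ vars* ts
  vars-annotate χ (var x)    = refl
  vars-annotate χ (fun g ts) = vars-annotate* _ ts
  vars-annotate* χ []       = refl
  vars-annotate* χ (t ∷ ts) = cong₂ _++_ (vars-annotate (χ 0) t) (vars-annotate* (χ ∘ suc) ts)

  canonical : ProbRule S V → ADP
  canonical rule = record
    { lhs         = R.lhs
    ; nonVariable = R.nonVariable
    ; rhs         = mapDist (λ r → #⟨ PosD r ⟩ (embed r)) R.rhs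
    ; flag        = true
    ; vars⊆       = All.map⁺ (All.map
        (λ {(_ , r)} r⊆ℓ {x} x∈ →
          r⊆ℓ (subst (x ∈_) (trans (vars-annotate _ (embed r)) (vars-embed r)) x∈))
        R.vars⊆)
    }
    where module R = ProbRule rule

  -- A function on PosV ℓ with values in PosV r ⊎ {⊥}, where ⊥ is nothing. Its values
  -- outside PosV ℓ are irrelevant.
  IsVRF : Term S V → Term♯ → (Position → Maybe Position) → Set
  IsVRF ℓ r φ = ∀ {ρ ρ′} → ρ ∈ PosV ℓ → φ ρ ≡ just ρ′ →
    ∃ λ x → ℓ ∣ ρ ≡ just (var x) × r ∣ ρ′ ≡ just (var x)

  -- u is the redex s|π; the positions τ with ρ.τ in PosD♯ u are those in PosD♯ (u|ρ).
  Ψ : Term S V → (Position → Maybe Position) → Term♯ → List Position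
  Ψ ℓ φ u = List.concatMap
    (λ ρ → maybe (λ ρ′ → List.map (ρ′ ++_) (maybe PosD♯ [] (u ∣ ρ))) [] (φ ρ)) (PosV ℓ)

  data Case : Set where
    at af nt : Case

  Applicable : Case → Term♯ → Position → Bool → Set
  Applicable at s π m = π ∈ PosD♯ s × m ≡ true
  Applicable af s π m = π ∈ PosD♯ s × m ≡ false
  Applicable nt s π m = π ∉ PosD♯ s × m ≡ true

  contract : Case → Term♯ → Position → List Position → Term♯ → (V → Term S V) → Term♯
  contract at s π Ψⱼ r σ = s [ #⟨ PosD♯ r ++ Ψⱼ ⟩ (bind (embed ∘ σ) r) ]at π
  contract af s π Ψⱼ r σ = ♭↑ π (s [ #⟨ PosD♯ r ++ Ψⱼ ⟩ (bind (embed ∘ σ) r) ]at π)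
  contract nt s π Ψⱼ r σ = s [ #⟨ Ψⱼ ⟩ (bind (embed ∘ σ) r) ]at π

  record Rewrites♯ (P : ADPProblem) (c : Case) (s : Term♯) (μ : List (ℝ × Term♯)) : Set where
    field
      adp        : ADP
      adp∈P      : adp ∈ P
      σ          : Substitution S V
      π          : Position
      π∈Pos      : π ∈ PosD∪D♯ s
      u          : Term♯
      subterm    : s ∣ π ≡ just u
      redex      : ♭ u ≡ bind (apply σ) (lhs adp)
      applicable : Applicable c s π (flag adp)
      result     : Pointwise
        (λ (p , r) (q , t) → p ≃ q × ∃ λ φ → IsVRF (lhs adp) r φ ×
          t ≡ contract c s π (Ψ (lhs adp) φ u) r (apply σ))
        (entries (rhs adp)) μ

  record ChainTree (P : ADPProblem) : Set₁ where
    field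
      tree : ProbTree Term♯
    open ProbTree tree public
    field
      A       : Pred Node 0ℓ
      A?      : Decidable A
      A⊆Inner : ∀ {v} → A v → Inner v
      step    : ∀ v → Inner v → ∃ λ c → ∃ λ μ →
                SuccDist v μ × Rewrites♯ P c (label v) μ ×
                (A v → c ≢ nt) × (¬ A v → c ≡ nt)
      infinitelyOften : ∀ (path : ℕ → Node) → (∀ n → Edge (path n) (path (suc n))) →
                        ∀ n → ∃ λ m → n ℕ.≤ m × A (path m)

  AST♯ : ADPProblem → Set₁
  AST♯ P = (𝔗 : ChainTree P) → ChainTree.LeafSum 𝔗 1ℝ

module _ {S : Signature} {V : Set} (_≟_ : DecidableEquality (Symbol S)) (R : PTRS S V) where

  open Annotated S V (definedSymbols _≟_ R)

  𝒟𝒫 : ADPProblem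
  𝒟𝒫 = List.map canonical R

  ADP-AST : ADPProblem → Set₁
  ADP-AST = AST♯

{-# OPTIONS --safe #-}

-- The tree underlying an RST is kept and only its labels are changed. Since all canonical
-- ADPs carry the flag true, erasing annotations turns every ADP step into an ℛ-step, so a
-- chain tree becomes an RST. Conversely, annotate every defined symbol: as ℛ is
-- non-duplicating, each variable occurrence of a right-hand side can be assigned its own
-- occurrence in the left-hand side, and with such a VRF no annotation is ever lost. Hence
-- every step is an (at)-step and every inner node lies in A.
module Submission where

open import Defs
open import Data.Bool.Base using (Bool; true; false; T; _∧_; if_then_else_)
open import Data.List.Base as List using (List; []; _∷_; _++_; filter; length)
open import Data.List.Membership.Propositional using (_∈_)
open import Data.List.Membership.Propositional.Properties
  using (∈-map⁺; ∈-map⁻; ∈-++⁺ˡ; ∈-++⁺ʳ; ∈-++⁻; ∈-concatMap⁺)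
import Data.List.Membership.DecPropositional as DecMembership
open import Data.List.Properties
  using (≡-dec; map-id; length-map; length-++; filter-++; ∷-injectiveˡ; ∷-injectiveʳ)
open import Data.List.Relation.Binary.Pointwise as Pointwise using (Pointwise; []; _∷_)
open import Data.List.Relation.Unary.All as All using (All; []; _∷_)
open import Data.List.Relation.Unary.AllPairs using ([]; _∷_)
open import Data.List.Relation.Unary.Any as Any using (here; there)
import Data.List.Relation.Unary.Any.Properties as Any
open import Data.List.Relation.Unary.Unique.Propositional using (Unique)
import Data.List.Relation.Unary.Unique.Propositional.Properties as Unique
open import Data.Maybe.Base using (Maybe; just; nothing; maybe; _>>=_)
open import Data.Maybe.Properties using (just-injective)
import Data.Maybe.Properties as Maybe
open import Data.Nat.Base as ℕ using (ℕ; zero; suc; _+_; s≤s)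
import Data.Nat.Properties as ℕ
open import Data.Product.Base using (∃; ∃₂; _×_; _,_; proj₁; proj₂; map₂)
open import Data.Sum.Base using (_⊎_; inj₁; inj₂; [_,_]′)
open import Data.Unit.Base using (tt)
open import Data.Vec.Base using (Vec; []; _∷_)
open import Function.Base using (_∘_; const)
open import Function.Bundles using (_⇔_; mk⇔)
open import Relation.Binary.Definitions using (DecidableEquality)
open import Relation.Binary.PropositionalEquality hiding ([_])
open import Relation.Nullary.Decidable using (Dec; does; yes; no; dec-true)
open import Relation.Nullary.Negation using (¬_; contradiction)

≡true⇒T : ∀ {b} → b ≡ true → T b
≡true⇒T refl = tt

-- Pairing two lists by index

module _ {A B : Set} (_≟_ : DecidableEquality A) where

  -- Keys left without a partner go to `nothing`, the value that stands for ⊥ in a variable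
  -- reposition function.
  zipLookup : List A → List B → A → Maybe B
  zipLookup []       _        a = nothing
  zipLookup (k ∷ ks) []       a = nothing
  zipLookup (k ∷ ks) (b ∷ bs) a with k ≟ a
  ... | yes _ = just b
  ... | no  _ = zipLookup ks bs a

  zipLookup-∈ : ∀ ks bs {a b} → zipLookup ks bs a ≡ just b → b ∈ bs
  zipLookup-∈ (k ∷ ks) (b ∷ bs) {a} eq with k ≟ a
  ... | yes _ = here (sym (just-injective eq))
  ... | no  _ = there (zipLookup-∈ ks bs eq)

  -- The length bound gives every value a key at the same index, and uniqueness of the keys prevents
  -- an earlier equal key from shadowing it.
  zipLookup-surjective : ∀ {ks bs b} → Unique ks → length bs ℕ.≤ length ks → b ∈ bs →
                         ∃ λ k → k ∈ ks × zipLookup ks bs k ≡ just b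
  zipLookup-surjective {k ∷ ks} {b ∷ bs} _ _ (here refl) = k , here refl , hit
    where
    hit : zipLookup (k ∷ ks) (b ∷ bs) k ≡ just b
    hit with k ≟ k
    ... | yes _   = refl
    ... | no  k≢k = contradiction refl k≢k
  zipLookup-surjective {k ∷ ks} {b′ ∷ bs} {b} (k∉ks ∷ unique) (s≤s le) (there b∈bs)
    with k′ , k′∈ks , eq ← zipLookup-surjective unique le b∈bs = k′ , there k′∈ks , hit
    where
    hit : zipLookup (k ∷ ks) (b′ ∷ bs) k′ ≡ just b
    hit with k ≟ k′
    ... | yes k≡k′ = contradiction k≡k′ (All.lookup k∉ks k′∈ks)
    ... | no  _    = eq

-- Positions and subterms, also in substitution instances

module _ {S : Signature} {V : Set} where

  head : Term S V → Symbol S ⊎ V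
  head (var x)    = inj₂ x
  head (fun f ts) = inj₁ f

  infix 8 _∣*_
  -- Agrees by computation with the function-symbol clause of `_∣_`, so that inductions on terms
  -- pass to argument vectors without conversion.
  _∣*_ : ∀ {n} → Vec (Term S V) n → ℕ × Position → Maybe (Term S V)
  ts ∣* (i , π) = at? i ts >>= λ t → t ∣ π

  private
    ∈-singleton-if : ∀ {b} → T b → _∈_ {A = Position} [] (if b then [] ∷ [] else [])
    ∈-singleton-if {true} _ = here refl

    ∈-singleton-if⁻ : ∀ b {π : Position} → π ∈ (if b then [] ∷ [] else []) → π ≡ [] × T b
    ∈-singleton-if⁻ true (here refl) = refl , tt

  -- In the vector version, `ts` is the list of arguments from index `k` on; hence its local index
  -- `i` appears as `k + i` in `Pos*`.
  Pos-complete  : ∀ (X : Symbol S ⊎ V → Bool) (t : Term S V) {π u} →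
                  t ∣ π ≡ just u → T (X (head u)) → π ∈ Pos X t
  Pos*-complete : ∀ (X : Symbol S ⊎ V → Bool) k {n} (ts : Vec (Term S V) n) i {π u} →
                  ts ∣* (i , π) ≡ just u → T (X (head u)) → (k + i) ∷ π ∈ Pos* X k ts
  Pos-complete X (var x)    {[]}    refl Xu = ∈-singleton-if Xu
  Pos-complete X (fun f ts) {[]}    refl Xu = ∈-++⁺ˡ (∈-singleton-if {X (inj₁ f)} Xu)
  Pos-complete X (fun f ts) {i ∷ π} eq   Xu =
    ∈-++⁺ʳ (if X (inj₁ f) then [] ∷ [] else []) (Pos*-complete X 0 ts i eq Xu)
  Pos*-complete X k (t ∷ ts) zero {π} eq Xu =
    subst (λ j → j ∷ π ∈ Pos* X k (t ∷ ts)) (sym (ℕ.+-identityʳ k))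
      (∈-++⁺ˡ (∈-map⁺ (k ∷_) (Pos-complete X t eq Xu)))
  Pos*-complete X k (t ∷ ts) (suc i) {π} eq Xu =
    subst (λ j → j ∷ π ∈ Pos* X k (t ∷ ts)) (sym (ℕ.+-suc k i))
      (∈-++⁺ʳ (List.map (k ∷_) (Pos X t)) (Pos*-complete X (suc k) ts i eq Xu))

  Pos-sound  : ∀ (X : Symbol S ⊎ V → Bool) (t : Term S V) {π} → π ∈ Pos X t →
               ∃ λ u → t ∣ π ≡ just u × T (X (head u))
  Pos*-sound : ∀ (X : Symbol S ⊎ V → Bool) k {n} (ts : Vec (Term S V) n) {π} → π ∈ Pos* X k ts →
               ∃₂ λ i ρ → π ≡ (k + i) ∷ ρ × ∃ λ u → ts ∣* (i , ρ) ≡ just u × T (X (head u))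
  Pos-sound X (var x) π∈ with refl , Xx ← ∈-singleton-if⁻ (X (inj₂ x)) π∈ = var x , refl , Xx
  Pos-sound X (fun f ts) π∈ with ∈-++⁻ (if X (inj₁ f) then [] ∷ [] else []) π∈
  ... | inj₁ π∈[] with refl , Xf ← ∈-singleton-if⁻ (X (inj₁ f)) π∈[] = fun f ts , refl , Xf
  ... | inj₂ π∈ts with i , ρ , refl , found ← Pos*-sound X 0 ts π∈ts = found
  Pos*-sound X k (t ∷ ts) π∈ with ∈-++⁻ (List.map (k ∷_) (Pos X t)) π∈
  ... | inj₁ π∈t with ρ , ρ∈ , refl ← ∈-map⁻ (k ∷_) π∈t =
    0 , ρ , cong (_∷ ρ) (sym (ℕ.+-identityʳ k)) , Pos-sound X t ρ∈
  ... | inj₂ π∈ts with i , ρ , refl , found ← Pos*-sound X (suc k) ts π∈ts =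
    suc i , ρ , cong (_∷ ρ) (sym (ℕ.+-suc k i)) , found

  -- The root position is empty while all others are not, and positions from different arguments
  -- differ in their first index. This supplies the distinct keys for `zipLookup-surjective`.
  Pos-unique  : ∀ (X : Symbol S ⊎ V → Bool) (t : Term S V) → Unique (Pos X t)
  Pos*-unique : ∀ (X : Symbol S ⊎ V → Bool) k {n} (ts : Vec (Term S V) n) → Unique (Pos* X k ts)
  Pos-unique X (var x) with X (inj₂ x)
  ... | true  = [] ∷ []
  ... | false = []
  Pos-unique X (fun f ts) with X (inj₁ f)
  ... | true  = All.tabulate (λ π∈ []≡π → nonRoot π∈ []≡π) ∷ Pos*-unique X 0 ts
    where
    nonRoot : ∀ {π} → π ∈ Pos* X 0 ts → [] ≢ π
    nonRoot π∈ refl with () ← proj₁ (proj₂ (proj₂ (Pos*-sound X 0 ts π∈)))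
  ... | false = Pos*-unique X 0 ts
  Pos*-unique X k []       = []
  Pos*-unique X k (t ∷ ts) =
    Unique.++⁺ (Unique.map⁺ ∷-injectiveʳ (Pos-unique X t)) (Pos*-unique X (suc k) ts) disjoint
    where
    disjoint : ∀ {π} → ¬ (π ∈ List.map (k ∷_) (Pos X t) × π ∈ Pos* X (suc k) ts)
    disjoint (π∈t , π∈ts)
      with ρ , _ , refl ← ∈-map⁻ (k ∷_) π∈t
      with i , _ , eq , _ ← Pos*-sound X (suc k) ts π∈ts =
      ℕ.m≢1+m+n k (∷-injectiveˡ eq)

  bind-∣  : ∀ (σ : V → Term S V) (t : Term S V) π {u x} →
            t ∣ π ≡ just (var x) → σ x ≡ u → bind σ t ∣ π ≡ just u
  bind*-∣ : ∀ (σ : V → Term S V) {n} (ts : Vec (Term S V) n) i π {u x} →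
            ts ∣* (i , π) ≡ just (var x) → σ x ≡ u → bind* σ ts ∣* (i , π) ≡ just u
  bind-∣ σ (var x)    []      refl eq′ = cong just eq′
  bind-∣ σ (fun f ts) (i ∷ π) eq   eq′ = bind*-∣ σ ts i π eq eq′
  bind*-∣ σ (t ∷ ts) zero    π eq eq′ = bind-∣ σ t π eq eq′
  bind*-∣ σ (t ∷ ts) (suc i) π eq eq′ = bind*-∣ σ ts i π eq eq′

  -- The two origins of a function symbol in an instance: the term itself, or the image of a
  -- variable at `ρ`. Abstracting the subterm function `sub` lets one predicate serve terms and
  -- argument vectors.
  BindPosition : (V → Term S V) → (Position → Maybe (Term S V)) → Position → Symbol S → Set
  BindPosition σ sub π f =
    (∃ λ us → sub π ≡ just (fun f us)) ⊎
    (∃₂ λ ρ τ → π ≡ ρ ++ τ × ∃₂ λ x ts → sub ρ ≡ just (var x) × σ x ∣ τ ≡ just (fun f ts))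

  bind-position  : ∀ (σ : V → Term S V) (t : Term S V) π {f ts} → bind σ t ∣ π ≡ just (fun f ts) →
                   BindPosition σ (t ∣_) π f
  bind*-position : ∀ (σ : V → Term S V) {n} (ts : Vec (Term S V) n) i π {f us} →
                   bind* σ ts ∣* (i , π) ≡ just (fun f us) →
                   BindPosition σ (λ ρ → ts ∣* (i , ρ)) π f
  bind-position σ (var x)    π       eq   = inj₂ ([] , π , refl , x , _ , refl , eq)
  bind-position σ (fun f ts) []      refl = inj₁ (ts , refl)
  bind-position σ (fun f ts) (i ∷ π) eq with bind*-position σ ts i π eq
  ... | inj₁ found                = inj₁ found
  ... | inj₂ (ρ , τ , refl , rest) = inj₂ (i ∷ ρ , τ , refl , rest)
  bind*-position σ (t ∷ ts) zero    π eq = bind-position σ t π eq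
  bind*-position σ (t ∷ ts) (suc i) π eq = bind*-position σ ts i π eq

  -- A variable reposition function for non-duplicating rules

  module _ (_≟_ : DecidableEquality V) where

    occurrences : V → Term S V → List Position
    occurrences x = Pos [ const false , (λ y → does (x ≟ y)) ]′

    -- Non-duplication counts entries of `vars`, whereas a reposition function pairs positions; this
    -- transfers the bound from one to the other.
    length-occurrences  : ∀ x (t : Term S V) → length (occurrences x t) ≡ length (filter (x ≟_) (vars t))
    length-occurrences* : ∀ x k {n} (ts : Vec (Term S V) n) →
      length (Pos* [ const false , (λ y → does (x ≟ y)) ]′ k ts) ≡ length (filter (x ≟_) (vars* ts))
    length-occurrences x (var y) with x ≟ y
    ... | yes _ = refl
    ... | no  _ = refl
    length-occurrences x (fun f ts) = length-occurrences* x 0 ts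
    length-occurrences* x k []       = refl
    length-occurrences* x k (t ∷ ts) = begin
      length (List.map (k ∷_) (occurrences x t) ++ rest)
        ≡⟨ length-++ (List.map (k ∷_) (occurrences x t)) ⟩
      length (List.map (k ∷_) (occurrences x t)) + length rest
        ≡⟨ cong₂ _+_ (trans (length-map (k ∷_) (occurrences x t)) (length-occurrences x t))
                     (length-occurrences* x (suc k) ts) ⟩
      length (filter (x ≟_) (vars t)) + length (filter (x ≟_) (vars* ts))
        ≡⟨ length-++ (filter (x ≟_) (vars t)) ⟨
      length (filter (x ≟_) (vars t) ++ filter (x ≟_) (vars* ts))
        ≡⟨ cong length (filter-++ (x ≟_) (vars t) (vars* ts)) ⟨
      length (filter (x ≟_) (vars t ++ vars* ts)) ∎
      where
      open ≡-Reasoning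
      rest = Pos* [ const false , (λ y → does (x ≟ y)) ]′ (suc k) ts

    occurrences-sound : ∀ x (t : Term S V) {π} → π ∈ occurrences x t → t ∣ π ≡ just (var x)
    occurrences-sound x t π∈ with Pos-sound _ t π∈
    ... | var y , eq , x≟y with x ≟ y
    ...   | yes refl = eq

    occurrences-complete : ∀ x (t : Term S V) {π} → t ∣ π ≡ just (var x) → π ∈ occurrences x t
    occurrences-complete x t eq =
      Pos-complete _ t eq (≡true⇒T (dec-true (x ≟ x) refl))

    -- For each variable separately, its i-th occurrence in `ℓ` is sent to its i-th occurrence in
    -- `r`, and to ⊥ if `r` has fewer.
    matchVariables : Term S V → Term S V → Position → Maybe Position
    matchVariables ℓ r ρ with ℓ ∣ ρ
    ... | just (var x) = zipLookup (≡-dec ℕ._≟_) (occurrences x ℓ) (occurrences x r) ρ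
    ... | just (fun _ _) = nothing
    ... | nothing = nothing

    matchVariables-sound : ∀ ℓ r {ρ ρ′} → matchVariables ℓ r ρ ≡ just ρ′ →
      ∃ λ x → ℓ ∣ ρ ≡ just (var x) × r ∣ ρ′ ≡ just (var x)
    matchVariables-sound ℓ r {ρ} eq with ℓ ∣ ρ
    ... | just (var x) = x , refl , occurrences-sound x r
      (zipLookup-∈ (≡-dec ℕ._≟_) (occurrences x ℓ) (occurrences x r) eq)

    -- This is where non-duplication enters: no variable occurrence of `r` lacks a source in `ℓ`
    -- from which annotations can be inherited.
    matchVariables-surjective : ∀ ℓ r {ρ′ x} →
      length (filter (x ≟_) (vars r)) ℕ.≤ length (filter (x ≟_) (vars ℓ)) →
      r ∣ ρ′ ≡ just (var x) →
      ∃ λ ρ → ℓ ∣ ρ ≡ just (var x) × matchVariables ℓ r ρ ≡ just ρ′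
    matchVariables-surjective ℓ r {ρ′} {x} le eq
      with ρ , ρ∈ , found ← zipLookup-surjective (≡-dec ℕ._≟_) (Pos-unique _ ℓ)
             (subst₂ ℕ._≤_ (sym (length-occurrences x r)) (sym (length-occurrences x ℓ)) le)
             (occurrences-complete x r eq) =
      ρ , ℓ∣ρ , matched
      where
      ℓ∣ρ : ℓ ∣ ρ ≡ just (var x)
      ℓ∣ρ = occurrences-sound x ℓ ρ∈
      matched : matchVariables ℓ r ρ ≡ just ρ′
      matched rewrite ℓ∣ρ = found

-- Changing the labels of a tree

relabel : ∀ {A B : Set} → (A → B) → ProbTree A → ProbTree B
relabel g 𝔗 = record
  { Node       = Node
  ; top        = top
  ; succ       = succ
  ; reachable  = reachable
  ; uniquePath = uniquePath
  ; prob       = prob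
  ; label      = g ∘ label
  ; isProb     = isProb
  ; prob-top   = prob-top
  }
  where open ProbTree 𝔗

SuccDist-relabel : ∀ {A B : Set} (g : A → B) (𝔗 : ProbTree A) {v μ} →
  ProbTree.SuccDist 𝔗 v μ → ProbTree.SuccDist (relabel g 𝔗) v (List.map (map₂ g) μ)
SuccDist-relabel g 𝔗 {v} {μ} (ws , ws↭ , pw) = ws , ws↭ ,
  -- `Pointwise.map⁺` maps both lists, so the nodes are mapped by the identity, which `map-id` then
  -- removes.
  subst (λ vs → Pointwise _ vs (List.map (map₂ g) μ)) (map-id ws)
    (Pointwise.map⁺ (λ w → w) (map₂ g) (Pointwise.map (map₂ (cong g)) pw))

-- Erasing all annotations and annotating all defined symbols

module AnnotatedProperties (S : Signature) (V : Set) (D : Symbol S → Bool) where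

  open Annotated S V D
  open DecMembership (≡-dec ℕ._≟_) using (_∈?_)

  ♭-embed  : ∀ t → ♭ (embed t) ≡ t
  ♭*-embed : ∀ {n} (ts : Vec (Term S V) n) → ♭* (embed* ts) ≡ ts
  ♭-embed (var x)    = refl
  ♭-embed (fun f ts) = cong (fun f) (♭*-embed ts)
  ♭*-embed []       = refl
  ♭*-embed (t ∷ ts) = cong₂ _∷_ (♭-embed t) (♭*-embed ts)

  ♭-annotate  : ∀ χ t → ♭ (annotate χ t) ≡ ♭ t
  ♭*-annotate : ∀ χ {n} (ts : Vec Term♯ n) → ♭* (annotate* χ ts) ≡ ♭* ts
  ♭-annotate χ (var x)    = refl
  ♭-annotate χ (fun g ts) = cong (fun (base g)) (♭*-annotate _ ts)
  ♭*-annotate χ []       = refl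
  ♭*-annotate χ (t ∷ ts) = cong₂ _∷_ (♭-annotate (χ 0) t) (♭*-annotate (χ ∘ suc) ts)

  ♭-bind  : ∀ σ r → ♭ (bind (embed ∘ σ) r) ≡ bind σ (♭ r)
  ♭*-bind : ∀ σ {n} (rs : Vec Term♯ n) → ♭* (bind* (embed ∘ σ) rs) ≡ bind* σ (♭* rs)
  ♭-bind σ (var x)    = ♭-embed (σ x)
  ♭-bind σ (fun g rs) = cong (fun (base g)) (♭*-bind σ rs)
  ♭*-bind σ []       = refl
  ♭*-bind σ (r ∷ rs) = cong₂ _∷_ (♭-bind σ r) (♭*-bind σ rs)

  ♭-∣  : ∀ t π {u} → t ∣ π ≡ just u → ♭ t ∣ π ≡ just (♭ u)
  ♭*-∣ : ∀ {n} (ts : Vec Term♯ n) i π {u} →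
         ts ∣* (i , π) ≡ just u → ♭* ts ∣* (i , π) ≡ just (♭ u)
  ♭-∣ t          []      refl = refl
  ♭-∣ (fun g ts) (i ∷ π) eq   = ♭*-∣ ts i π eq
  ♭*-∣ (t ∷ ts) zero    π eq = ♭-∣ t π eq
  ♭*-∣ (t ∷ ts) (suc i) π eq = ♭*-∣ ts i π eq

  ♭-replace  : ∀ s t π → ♭ (s [ t ]at π) ≡ ♭ s [ ♭ t ]at π
  ♭*-replace : ∀ {n} (ss : Vec Term♯ n) i t π →
    ♭* (modifyAt i (_[ t ]at π) ss) ≡ modifyAt i (_[ ♭ t ]at π) (♭* ss)
  ♭-replace s          t []      = refl
  ♭-replace (var x)    t (i ∷ π) = refl
  ♭-replace (fun g ss) t (i ∷ π) = cong (fun (base g)) (♭*-replace ss i t π)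
  ♭*-replace []       i       t π = refl
  ♭*-replace (s ∷ ss) zero    t π = cong (_∷ ♭* ss) (♭-replace s t π)
  ♭*-replace (s ∷ ss) (suc i) t π = cong (♭ s ∷_) (♭*-replace ss i t π)

  -- #_{Pos_D(t)}(t) in the paper's notation.
  full  : Term S V → Term♯
  full* : ∀ {n} → Vec (Term S V) n → Vec Term♯ n
  full (var x)    = var x
  full (fun f ts) = fun (mark true f) (full* ts)
  full* []       = []
  full* (t ∷ ts) = full t ∷ full* ts

  ♭-full  : ∀ t → ♭ (full t) ≡ t
  ♭*-full : ∀ {n} (ts : Vec (Term S V) n) → ♭* (full* ts) ≡ ts
  ♭-full (var x)    = refl
  ♭-full (fun f ts) = cong (fun f) (♭*-full ts)
  ♭*-full []       = refl
  ♭*-full (t ∷ ts) = cong₂ _∷_ (♭-full t) (♭*-full ts)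

  full-∣  : ∀ t π {u} → t ∣ π ≡ just u → full t ∣ π ≡ just (full u)
  full*-∣ : ∀ {n} (ts : Vec (Term S V) n) i π {u} →
            ts ∣* (i , π) ≡ just u → full* ts ∣* (i , π) ≡ just (full u)
  full-∣ t          []      refl = refl
  full-∣ (fun g ts) (i ∷ π) eq   = full*-∣ ts i π eq
  full*-∣ (t ∷ ts) zero    π eq = full-∣ t π eq
  full*-∣ (t ∷ ts) (suc i) π eq = full*-∣ ts i π eq

  full-replace  : ∀ s t π → full (s [ t ]at π) ≡ full s [ full t ]at π
  full*-replace : ∀ {n} (ss : Vec (Term S V) n) i t π →
    full* (modifyAt i (_[ t ]at π) ss) ≡ modifyAt i (_[ full t ]at π) (full* ss)
  full-replace s          t []      = refl
  full-replace (var x)    t (i ∷ π) = refl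
  full-replace (fun g ss) t (i ∷ π) = cong (fun (mark true g)) (full*-replace ss i t π)
  full*-replace []       i       t π = refl
  full*-replace (s ∷ ss) zero    t π = cong (_∷ full* ss) (full-replace s t π)
  full*-replace (s ∷ ss) (suc i) t π = cong (full s ∷_) (full*-replace ss i t π)

  -- The flag of `mark true f` computes to `D f`, so the assumption on the symbol is itself the
  -- required proof.
  full-annotated  : ∀ t π {g us} → full t ∣ π ≡ just (fun g us) → T (D (base g)) → T (annotated g)
  full*-annotated : ∀ {n} (ts : Vec (Term S V) n) i π {g us} →
    full* ts ∣* (i , π) ≡ just (fun g us) → T (D (base g)) → T (annotated g)
  full-annotated (fun f ts) []      refl Df = Df
  full-annotated (fun f ts) (i ∷ π) eq   Df = full*-annotated ts i π eq Df
  full*-annotated (t ∷ ts) zero    π eq Df = full-annotated t π eq Df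
  full*-annotated (t ∷ ts) (suc i) π eq Df = full*-annotated ts i π eq Df

  private
    fun-cong : ∀ f {b b′} .{d : T b → T (D f)} .{d′ : T b′ → T (D f)}
               {ts us : Vec Term♯ (arity S f)} →
               b ≡ b′ → ts ≡ us → fun (sym♯ f b d) ts ≡ fun (sym♯ f b′ d′) us
    fun-cong f refl refl = refl

    ∧-guard : ∀ b d → (T d → b ≡ true) → b ∧ d ≡ d
    ∧-guard b     true  h = cong (_∧ true) (h tt)
    ∧-guard true  false h = refl
    ∧-guard false false h = refl

  -- Since `mark` takes the conjunction of `χ` with `D`, the value of `χ` matters only at defined
  -- symbols. The definedness proof inside a symbol is irrelevant, so equal flags give equal
  -- symbols.
  annotate-full  : ∀ χ t →
    (∀ π {g us} → t ∣ π ≡ just (fun g us) → T (D (base g)) → χ π ≡ true) →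
    annotate χ t ≡ full (♭ t)
  annotate*-full : ∀ χ {n} (ts : Vec Term♯ n) →
    (∀ i π {g us} → ts ∣* (i , π) ≡ just (fun g us) → T (D (base g)) → χ i π ≡ true) →
    annotate* χ ts ≡ full* (♭* ts)
  annotate-full χ (var x)    h = refl
  annotate-full χ (fun g ts) h =
    fun-cong (base g) (∧-guard (χ []) (D (base g)) (h [] refl))
      (annotate*-full (λ i π → χ (i ∷ π)) ts (λ i π → h (i ∷ π)))
  annotate*-full χ []       h = refl
  annotate*-full χ (t ∷ ts) h =
    cong₂ _∷_ (annotate-full (χ 0) t (h 0)) (annotate*-full (χ ∘ suc) ts (λ i → h (suc i)))

  #-full : ∀ Φ t → (∀ π {g us} → t ∣ π ≡ just (fun g us) → T (D (base g)) → π ∈ Φ) →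
           #⟨ Φ ⟩ t ≡ full (♭ t)
  #-full Φ t h = annotate-full _ t λ π eq Dg → dec-true (π ∈? Φ) (h π eq Dg)

  canonical-full : ∀ r → #⟨ PosD r ⟩ (embed r) ≡ full r
  canonical-full r = trans
    (#-full (PosD r) (embed r) λ π eq Dg →
      Pos-complete _ r (subst (λ t → t ∣ π ≡ _) (♭-embed r) (♭-∣ (embed r) π eq)) Dg)
    (cong full (♭-embed r))

  -- Preservation of annotations under contraction

  Ψ-complete : ∀ ℓ φ u {ρ ρ′ τ t} →
               ρ ∈ PosV ℓ → φ ρ ≡ just ρ′ → u ∣ ρ ≡ just t → τ ∈ PosD♯ t →
               ρ′ ++ τ ∈ Ψ ℓ φ u
  Ψ-complete ℓ φ u {ρ} {ρ′} {τ} {t} ρ∈ φρ uρ τ∈ =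
    ∈-concatMap⁺ _ (Any.map (λ { refl → hit φρ uρ }) ρ∈)
    where
    -- Here `a` and `b` generalise `φ ρ` and `u ∣ ρ`, so that both equations can be matched with
    -- `refl`.
    hit : ∀ {a b} → a ≡ just ρ′ → b ≡ just t →
          ρ′ ++ τ ∈ maybe {B = λ _ → List Position}
            (λ ρ″ → List.map (ρ″ ++_) (maybe {B = λ _ → List Position} PosD♯ [] b)) [] a
    hit refl refl = ∈-map⁺ (ρ′ ++_) τ∈

  -- A defined symbol of the instance lies either in `r`, where `full r` annotates it, or in a copy
  -- of `σ x`. In the second case the copy has a source occurrence of `x` in `ℓ`, below which the
  -- fully annotated redex carries the annotation, so `Ψ` transports it.
  full-contract : ∀ (_≟_ : DecidableEquality V) ℓ r σ →
    (∀ x → length (filter (x ≟_) (vars r)) ℕ.≤ length (filter (x ≟_) (vars ℓ))) →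
    #⟨ PosD♯ (full r) ++ Ψ ℓ (matchVariables _≟_ ℓ r) (full (bind σ ℓ)) ⟩ (bind (embed ∘ σ) (full r))
      ≡ full (bind σ r)
  full-contract _≟_ ℓ r σ nd =
    trans (#-full _ (bind (embed ∘ σ) (full r)) covered)
          (cong full (trans (♭-bind σ (full r)) (cong (bind σ) (♭-full r))))
    where
    φ = matchVariables _≟_ ℓ r
    covered : ∀ π {g us} → bind (embed ∘ σ) (full r) ∣ π ≡ just (fun g us) → T (D (base g)) →
              π ∈ PosD♯ (full r) ++ Ψ ℓ φ (full (bind σ ℓ))
    covered π {g} eq Dg with bind-position (embed ∘ σ) (full r) π eq
    ... | inj₁ (us , r∣π) =
      ∈-++⁺ˡ (Pos-complete _ (full r) r∣π (full-annotated r π r∣π Dg))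
    ... | inj₂ (ρ′ , τ , refl , x , ts , r∣ρ′ , σx∣τ)
      with ρ , ℓ∣ρ , φρ ← matchVariables-surjective _≟_ ℓ r {ρ′} (nd x)
             (subst (λ t → t ∣ ρ′ ≡ just (var x)) (♭-full r) (♭-∣ (full r) ρ′ r∣ρ′)) =
      ∈-++⁺ʳ (PosD♯ (full r)) (Ψ-complete ℓ φ (full (bind σ ℓ)) {ρ} {ρ′} {τ}
        (Pos-complete _ ℓ ℓ∣ρ tt) φρ
        (full-∣ (bind σ ℓ) ρ (bind-∣ σ ℓ ρ ℓ∣ρ refl))
        (Pos-complete _ (full (σ x)) full-σx∣τ Dg))
      where
      -- The symbol was found in the unannotated `embed (σ x)`; erasing leads to `σ x`, and `full-∣`
      -- to the copy inside the redex.
      full-σx∣τ : full (σ x) ∣ τ ≡ just (full (♭ (fun g ts)))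
      full-σx∣τ = full-∣ (σ x) τ
        (subst (λ t → t ∣ τ ≡ just (♭ (fun g ts))) (♭-embed (σ x)) (♭-∣ (embed (σ x)) τ σx∣τ))

-- Translating rewrite steps in both directions

module _ {S : Signature} {V : Set} (_≟ˢ_ : DecidableEquality (Symbol S)) (R : PTRS S V) where

  private
    D : Symbol S → Bool
    D = definedSymbols _≟ˢ_ R

  open Annotated S V D
  open AnnotatedProperties S V D

  lhs-root-defined : ∀ {rule f ts} → rule ∈ R → ProbRule.lhs rule ≡ fun f ts → T (D f)
  lhs-root-defined {rule} {f} rule∈R eq = Any.any⁺ _ (Any.map matches rule∈R)
    where
    matches : ∀ {rule′} → rule ≡ rule′ →
              T (does (Maybe.≡-dec _≟ˢ_ (root (ProbRule.lhs rule′)) (just f)))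
    matches refl = ≡true⇒T (dec-true (Maybe.≡-dec _≟ˢ_ _ (just f)) (cong root eq))

  -- A left-hand side is no variable, so its root survives instantiation. Hence every redex sits at
  -- a defined symbol, as ADP steps demand.
  instance-root-defined : ∀ {rule} (σ : V → Term S V) → rule ∈ R →
    ∃₂ λ f ts → bind σ (ProbRule.lhs rule) ≡ fun f ts × T (D f)
  instance-root-defined {rule} σ rule∈R with ProbRule.lhs rule in eq
  ... | var x    = contradiction eq (ProbRule.nonVariable rule x)
  ... | fun f ts = f , bind* σ ts , refl , lhs-root-defined rule∈R eq

  -- Stated for arbitrary `Φ`, since (at) and (nt) differ only in the set of positions they
  -- annotate.
  ♭-instance : ∀ s π Φ r σ →
    ♭ (s [ #⟨ Φ ⟩ (bind (embed ∘ σ) (#⟨ PosD r ⟩ (embed r))) ]at π) ≡ ♭ s [ bind σ r ]at π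
  ♭-instance s π Φ r σ = trans (♭-replace s _ π) (cong (♭ s [_]at π)
    (trans (♭-annotate _ (bind (embed ∘ σ) (#⟨ PosD r ⟩ (embed r))))
    (trans (♭-bind σ (#⟨ PosD r ⟩ (embed r)))
    (cong (bind σ) (trans (♭-annotate _ (embed r)) (♭-embed r))))))

  ♭-contract : ∀ c s π Ψⱼ r σ → c ≢ af →
    ♭ (contract c s π Ψⱼ (#⟨ PosD r ⟩ (embed r)) σ) ≡ ♭ s [ bind σ r ]at π
  ♭-contract at s π Ψⱼ r σ _     = ♭-instance s π (PosD♯ (#⟨ PosD r ⟩ (embed r)) ++ Ψⱼ) r σ
  ♭-contract af s π Ψⱼ r σ af≢af = contradiction refl af≢af
  ♭-contract nt s π Ψⱼ r σ _     = ♭-instance s π Ψⱼ r σ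

  ♭-step : ∀ {c s μ} → Rewrites♯ (𝒟𝒫 _≟ˢ_ R) c s μ → Rewrites R (♭ s) (List.map (map₂ ♭) μ)
  ♭-step {c} {s} {μ} record { adp∈P = adp∈P ; σ = σ ; π = π ; subterm = subterm
                            ; redex = redex ; applicable = applicable ; result = result }
    -- Identifying the ADP as `canonical rule` makes its flag compute to `true`, which rules out
    -- case (af).
    with rule , rule∈R , refl ← ∈-map⁻ canonical adp∈P = record
    { rule   = rule
    ; rule∈R = rule∈R
    ; σ      = σ
    ; π      = π
    ; redex  = trans (♭-∣ s π subterm) (cong just redex)
    ; result = ♭-result (entries (ProbRule.rhs rule)) result
    }
    where
    c≢af : ∀ {c} → Applicable c s π true → c ≢ af
    c≢af (_ , ()) refl

    ♭-result : ∀ {ℓ u ν} es →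
      Pointwise (λ (p , r) (q , t) → p ≃ q × ∃ λ φ → IsVRF ℓ r φ ×
                  t ≡ contract c s π (Ψ ℓ φ u) r (apply σ))
                (List.map (map₂ (λ r → #⟨ PosD r ⟩ (embed r))) es) ν →
      Pointwise (λ (p , r) (q , t) → p ≃ q × t ≡ ♭ s [ bind (apply σ) r ]at π)
                es (List.map (map₂ ♭) ν)
    ♭-result []             []                           = []
    ♭-result ((_ , r) ∷ es) ((p≃q , _ , _ , refl) ∷ res) =
      (p≃q , ♭-contract c s π _ r (apply σ) (c≢af applicable)) ∷ ♭-result es res

  -- In `full s` the root of the redex is annotated and the canonical flag is `true`, so case (at)
  -- applies; by `full-contract` the results are again fully annotated.
  full-step : (_≟_ : DecidableEquality V) → NonDuplicating _≟_ R → ∀ {s μ} →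
              Rewrites R s μ → Rewrites♯ (𝒟𝒫 _≟ˢ_ R) at (full s) (List.map (map₂ full) μ)
  full-step _≟_ nonDup {s} record { rule = rule ; rule∈R = rule∈R ; σ = σ ; π = π
                                  ; redex = redex ; result = result }
    with f , ts , ℓσ≡ , Df ← instance-root-defined (apply σ) rule∈R = record
    { adp        = canonical rule
    ; adp∈P      = ∈-map⁺ canonical rule∈R
    ; σ          = σ
    ; π          = π
    ; π∈Pos      = Pos-complete _ (full s) root-subterm Df
    ; u          = full ℓσ
    ; subterm    = full-∣ s π redex
    ; redex      = ♭-full ℓσ
    ; applicable = Pos-complete _ (full s) root-subterm Df , refl
    ; result     = full-result (nonDup rule∈R) result
    }
    where
    ℓ  = ProbRule.lhs rule
    ℓσ = bind (apply σ) ℓ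

    root-subterm : full s ∣ π ≡ just (full (fun f ts))
    root-subterm = full-∣ s π (trans redex (cong just ℓσ≡))

    full-result : ∀ {es ν} →
      All (λ (_ , r) → ∀ x → length (filter (x ≟_) (vars r)) ℕ.≤ length (filter (x ≟_) (vars ℓ))) es →
      Pointwise (λ (p , r) (q , t) → p ≃ q × t ≡ s [ bind (apply σ) r ]at π) es ν →
      Pointwise (λ (p , r) (q , t) → p ≃ q × ∃ λ φ → IsVRF ℓ r φ ×
                  t ≡ contract at (full s) π (Ψ ℓ φ (full ℓσ)) r (apply σ))
                (List.map (map₂ (λ r → #⟨ PosD r ⟩ (embed r))) es) (List.map (map₂ full) ν)
    full-result [] [] = []
    full-result {(_ , r) ∷ _} (nd ∷ nds) ((p≃q , refl) ∷ res) =
      (p≃q , matchVariables _≟_ ℓ r , isVRF , step) ∷ full-result nds res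
      where
      isVRF : IsVRF ℓ (#⟨ PosD r ⟩ (embed r)) (matchVariables _≟_ ℓ r)
      isVRF {ρ} {ρ′} _ eq with x , ℓ∣ρ , r∣ρ′ ← matchVariables-sound _≟_ ℓ r {ρ} eq =
        x , ℓ∣ρ , subst (λ t → t ∣ ρ′ ≡ just (var x)) (sym (canonical-full r)) (full-∣ r ρ′ r∣ρ′)

      step : full (s [ bind (apply σ) r ]at π) ≡
             contract at (full s) π (Ψ ℓ (matchVariables _≟_ ℓ r) (full ℓσ))
               (#⟨ PosD r ⟩ (embed r)) (apply σ)
      -- After this rewriting, the canonical right-hand side has the form `full r` that
      -- `full-contract` expects.
      step rewrite canonical-full r =
        trans (full-replace s (bind (apply σ) r) π)
              (cong (full s [_]at π) (sym (full-contract _≟_ ℓ r (apply σ) nd)))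

  -- Translating trees

  ♭-tree : ChainTree (𝒟𝒫 _≟ˢ_ R) → RST R
  ♭-tree 𝔗 = record
    { tree = relabel ♭ tree
    ; step = λ v inner → let (_ , μ , succDist , rewrites , _) = step v inner in
               List.map (map₂ ♭) μ , SuccDist-relabel ♭ tree succDist , ♭-step rewrites
    }
    where open ChainTree 𝔗

  full-tree : (_≟_ : DecidableEquality V) → NonDuplicating _≟_ R → RST R → ChainTree (𝒟𝒫 _≟ˢ_ R)
  full-tree _≟_ nonDup 𝔗 = record
    { tree            = relabel full tree
    ; A               = Inner
    ; A?              = inner?
    ; A⊆Inner         = λ inner → inner
    ; step            = λ v inner → let (μ , succDist , rewrites) = step v inner in
        at , List.map (map₂ full) μ , SuccDist-relabel full tree succDist ,
        full-step _≟_ nonDup rewrites , (λ _ ()) , (λ ¬inner → contradiction inner ¬inner)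
    -- Each node of an infinite path has a successor on it and is thus inner, so index `n` itself is
    -- a witness.
    ; infinitelyOften = λ path edges n → n , ℕ.≤-refl , edge⇒inner (edges n)
    }
    where
    open RST 𝔗

    inner? : ∀ v → Dec (Inner v)
    inner? v with succ v
    ... | []    = no (λ []≢[] → []≢[] refl)
    ... | _ ∷ _ = yes (λ ())

    edge⇒inner : ∀ {v w} → Edge v w → Inner v
    edge⇒inner edge leaf with () ← subst (_ ∈_) leaf edge

theorem13 : (S : Signature) (finite : Finite (Symbol S))
    (V : Set) (_≟_ : DecidableEquality V)
    (R : PTRS S V) → NonDuplicating _≟_ R →
    AST R ⇔ ADP-AST (finite⇒≟ finite) R (𝒟𝒫 (finite⇒≟ finite) R)
theorem13 S finite V _≟_ R nonDup = mk⇔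
  -- `LeafSum` depends only on nodes, successors and probabilities, which relabelling keeps, so the
  -- leaf sums of both trees agree by computation.
  (λ ast 𝔗 → ast (♭-tree (finite⇒≟ finite) R 𝔗))
  (λ ast 𝔗 → ast (full-tree (finite⇒≟ finite) R _≟_ nonDup 𝔗))
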